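{- Let $G$ be a finite simple connected graph and let $S\subseteq V(G)$ with $|S|=k\geq 2$. Then $\kappa_k^*(G)\leq \kappa_k^*(G[S])+(|V(G)|-k)$.
   Context: $G[S]$ is the subgraph of $G$ induced by $S$. For $S\subseteq V(H)$ with $|S|\ge 2$, an $S$-Steiner tree of a graph $H$ is a subtree $T$ of $H$ with $S\subseteq V(T)$ all of whose leaves belong to $S$. A family of $S$-Steiner trees $T_1,\dots,T_k$ is completely independent if for all $1\le p<q\le k$: $E(T_p)\cap E(T_q)=\emptyset$, $V(T_p)\cap V(T_q)=S$, and for any two vertices $x_1,x_2\in S$ the $(x_1,x_2)$-paths in $T_p$ and in $T_q$ are internally disjoint. $\kappa^*_H(S)$ is the maximum number of trees in a completely independent family of $S$-Steiner trees in $H$, and $\kappa_k^*(H)=\min\{\kappa^*_H(S): S\subseteq V(H),\ |S|=k\}$. -}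

module Defs where

open import Data.Bool using (_∧_)
import Data.Bool.Properties as Bool
open import Data.Fin using (Fin; zero; suc)
import Data.Fin as Fin
import Data.Fin.Properties as Fin
open import Data.Fin.Subset
  using (Subset; inside; outside; _∈_; _⊆_; _∩_; ∣_∣; Nonempty)
open import Data.Fin.Subset.Properties
  using (_∈?_; _⊆?_; nonempty?; anySubset?)
open import Data.List using (List; []; _∷_; length; head; last; lookup)
import Data.List.Membership.Propositional as List
open import Data.List.Membership.Propositional.Properties using (∈-lookup)
open import Data.List.Relation.Unary.All as All using (All)
open import Data.List.Relation.Unary.AllPairs using (_∷_; allPairs?)
open import Data.List.Relation.Unary.Linked using (Linked; _∷_; linked?)
open import Data.List.Relation.Unary.Unique.Propositional using (Unique)
import Data.Maybe.Properties as Maybe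
open import Data.Maybe using (just)
open import Data.Nat using (ℕ; zero; suc; _≤_; z≤n; s≤s; s≤s⁻¹; _≤?_; _≟_)
import Data.Nat.Properties as ℕ
open import Data.Product using (Σ; ∃; _×_; _,_; proj₁; proj₂)
open import Data.Sum using (_⊎_; inj₁; inj₂)
open import Data.Vec using (Vec; []; _∷_; tabulate; here; there)
import Data.Vec as Vec
import Data.Vec.Properties as Vec
open import Function using (_∘_)
open import Relation.Binary using (tri<; tri≈; tri>)
open import Relation.Binary.PropositionalEquality
  using (_≡_; _≢_; refl; sym; trans; subst; cong)
open import Relation.Nullary using (¬_; Dec; yes; no; contradiction)
open import Relation.Nullary.Decidable
  using (map′; ¬?; _×-dec_; _⊎-dec_; _→-dec_; decidable-stable)
open import Relation.Unary using (Decidable)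

-- A graph whose vertices form an arbitrary subset of Fin n, so that its
-- subgraphs are again graphs over the same Fin n.  This is only the data;
-- `IsSimple` makes it a simple graph.
record Graph (n : ℕ) : Set where
  constructor graph
  field
    V : Subset n
    N : Vec (Subset n) n

  neighbours : Fin n → Subset n
  neighbours = Vec.lookup N

  infix 4 _~_
  _~_ : Fin n → Fin n → Set
  u ~ v = v ∈ neighbours u

  degree : Fin n → ℕ
  degree v = ∣ neighbours v ∣

open Graph public using (V)

record IsSimple {n} (G : Graph n) : Set where
  open Graph G using (_~_)
  field
    symmetric   : ∀ u v → u ~ v → v ~ u
    irreflexive : ∀ u → ¬ (u ~ u)
    endpoints   : ∀ u v → u ~ v → u ∈ V G

record IsSubgraph {n} (T H : Graph n) : Set where
  field
    vertices : V T ⊆ V H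
    edges    : ∀ u v → Graph._~_ T u v → Graph._~_ H u v

infix 8 _[_]
_[_] : ∀ {n} → Graph n → Subset n → Graph n
G [ S ] = graph S (tabulate λ u → tabulate λ v →
  Vec.lookup S u ∧ Vec.lookup S v ∧ Vec.lookup (Graph.neighbours G u) v)

-- Paths are given by their lists of vertices, in order.
record IsPath {n} (G : Graph n) (x y : Fin n) (P : List (Fin n)) : Set where
  field
    starts   : head P ≡ just x
    ends     : last P ≡ just y
    vertices : All (_∈ V G) P
    adjacent : Linked (Graph._~_ G) P
    distinct : Unique P

Connected : ∀ {n} → Graph n → Set
Connected G =
  Nonempty (V G) × (∀ x y → x ∈ V G → y ∈ V G → ∃ λ P → IsPath G x y P)

-- A cycle is a path on at least three vertices whose ends are adjacent.
Acyclic : ∀ {n} → Graph n → Set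
Acyclic G = ∀ x y P → IsPath G x y P → ¬ (3 ≤ length P × Graph._~_ G y x)

record IsTree {n} (T : Graph n) : Set where
  field
    simple    : IsSimple T
    connected : Connected T
    acyclic   : Acyclic T

record IsSteinerTree {n} (H : Graph n) (S : Subset n) (T : Graph n) : Set where
  field
    tree      : IsTree T
    subgraph  : IsSubgraph T H
    terminals : S ⊆ V T
    leaves    : ∀ v → v ∈ V T → Graph.degree T v ≡ 1 → v ∈ S

-- For two paths with the same ends x and y.
InternallyDisjoint : ∀ {n} → Fin n → Fin n → List (Fin n) → List (Fin n) → Set
InternallyDisjoint x y P Q = ∀ z → z List.∈ P → z List.∈ Q → z ≡ x ⊎ z ≡ y

record Independent {n} (S : Subset n) (T U : Graph n) : Set where
  field
    edgeDisjoint   : ∀ u v → ¬ (Graph._~_ T u v × Graph._~_ U u v)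
    commonVertices : V T ∩ V U ≡ S
    pathsDisjoint  : ∀ x y → x ∈ S → y ∈ S → x ≢ y →
                     ∀ P → IsPath T x y P → ∀ Q → IsPath U x y Q →
                     InternallyDisjoint x y P Q

record IsCompletelyIndependent {n m} (H : Graph n) (S : Subset n)
                               (T : Vec (Graph n) m) : Set where
  field
    steiner     : ∀ p → IsSteinerTree H S (Vec.lookup T p)
    independent : ∀ p q → p Fin.< q →
                  Independent S (Vec.lookup T p) (Vec.lookup T q)

HasFamily : ∀ {n} → Graph n → Subset n → ℕ → Set
HasFamily {n} H S m =
  ∃ λ (T : Vec (Graph n) m) → IsCompletelyIndependent H S T

IsMaximum IsMinimum : (ℕ → Set) → ℕ → Set
IsMaximum A m = A m × (∀ i → A i → i ≤ m)
IsMinimum A m = A m × (∀ i → A i → m ≤ i)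

-- HasFamily is decidable by exhaustive search, and edge-disjointness bounds the
-- size of a family, so the maximum size exists.

Unique⇒lookup-injective : ∀ {X : Set} {xs : List X} → Unique xs →
                          ∀ {i j} → lookup xs i ≡ lookup xs j → i ≡ j
Unique⇒lookup-injective (x ∷ u) {zero}  {zero}  eq = refl
Unique⇒lookup-injective (x ∷ u) {zero}  {suc j} eq =
  contradiction eq (All.lookup x (∈-lookup j))
Unique⇒lookup-injective (x ∷ u) {suc i} {zero}  eq =
  contradiction (sym eq) (All.lookup x (∈-lookup i))
Unique⇒lookup-injective (x ∷ u) {suc i} {suc j} eq =
  cong suc (Unique⇒lookup-injective u eq)

anyList≤? : ∀ {n} {A : List (Fin n) → Set} → Decidable A → ∀ b →
            Dec (∃ λ xs → length xs ≤ b × A xs)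
anyList≤? A? zero =
  map′ (λ a → [] , z≤n , a) (λ { ([] , _ , a) → a }) (A? [])
anyList≤? A? (suc b) =
  map′ (λ { (inj₁ a) → [] , z≤n , a
          ; (inj₂ (x , xs , l , a)) → x ∷ xs , s≤s l , a })
       (λ { ([] , _ , a) → inj₁ a
          ; (x ∷ xs , l , a) → inj₂ (x , xs , s≤s⁻¹ l , a) })
       (A? [] ⊎-dec Fin.any? (λ x → anyList≤? (A? ∘ (x ∷_)) b))

anyVec? : ∀ {X : Set} →
          (∀ {A : X → Set} → Decidable A → Dec (∃ A)) →
          ∀ {m} {A : Vec X m → Set} → Decidable A → Dec (∃ A)
anyVec? any? {zero}  A? = map′ ([] ,_) (λ { ([] , a) → a }) (A? [])
anyVec? any? {suc m} A? =
  map′ (λ { (x , xs , a) → x ∷ xs , a }) (λ { (x ∷ xs , a) → x , xs , a })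
       (any? (λ x → anyVec? any? (A? ∘ (x ∷_))))

anyGraph? : ∀ {n} {A : Graph n → Set} → Decidable A → Dec (∃ A)
anyGraph? A? =
  map′ (λ { (W , M , a) → graph W M , a }) (λ { (graph W M , a) → W , M , a })
       (anySubset? (λ W → anyVec? anySubset? (λ M → A? (graph W M))))

module _ {n} (G : Graph n) where
  open Graph G

  _~?_ : ∀ u v → Dec (u ~ v)
  u ~? v = v ∈? neighbours u

  isSimple? : Dec (IsSimple G)
  isSimple? = map′
    (λ (a , b , c) →
      record { symmetric = a ; irreflexive = b ; endpoints = c })
    (λ s → let open IsSimple s in symmetric , irreflexive , endpoints)
    (Fin.all? (λ u → Fin.all? (λ v → (u ~? v) →-dec (v ~? u)))
     ×-dec Fin.all? (λ u → ¬? (u ~? u))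
     ×-dec Fin.all? (λ u → Fin.all? (λ v → (u ~? v) →-dec (u ∈? V G))))

  isPath? : ∀ x y → Decidable (IsPath G x y)
  isPath? x y P = map′
    (λ (a , b , c , d , e) → record
      { starts = a ; ends = b ; vertices = c ; adjacent = d ; distinct = e })
    (λ p → let open IsPath p in starts , ends , vertices , adjacent , distinct)
    (Maybe.≡-dec Fin._≟_ (head P) (just x)
     ×-dec Maybe.≡-dec Fin._≟_ (last P) (just y)
     ×-dec All.all? (_∈? V G) P
     ×-dec linked? _~?_ P
     ×-dec allPairs? (λ u v → ¬? (u Fin.≟ v)) P)

  anyPath? : ∀ x y {A : List (Fin n) → Set} → Decidable A →
             Dec (∃ λ P → IsPath G x y P × A P)
  anyPath? x y A? = map′
    (λ (P , _ , pa) → P , pa)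
    (λ (P , p , a) →
      P , Fin.injective⇒≤ (Unique⇒lookup-injective (IsPath.distinct p)) , p , a)
    (anyList≤? (λ P → isPath? x y P ×-dec A? P) n)

  allPaths? : ∀ x y {A : List (Fin n) → Set} → Decidable A →
              Dec (∀ P → IsPath G x y P → A P)
  allPaths? x y A? = map′
    (λ none P p → decidable-stable (A? P) (λ ¬a → none (P , p , ¬a)))
    (λ all (P , p , ¬a) → ¬a (all P p))
    (¬? (anyPath? x y (¬? ∘ A?)))

  connected? : Dec (Connected G)
  connected? = nonempty? (V G) ×-dec
    Fin.all? (λ x → Fin.all? (λ y → (x ∈? V G) →-dec ((y ∈? V G) →-dec
      map′ (λ (P , p , _) → P , p) (λ (P , p) → P , p , refl)
           (anyPath? x y (λ _ → yes (refl {x = 0}))))))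

  acyclic? : Dec (Acyclic G)
  acyclic? = Fin.all? (λ x → Fin.all? (λ y →
    allPaths? x y (λ P → ¬? ((3 ≤? length P) ×-dec (y ~? x)))))

  isTree? : Dec (IsTree G)
  isTree? = map′
    (λ (a , b , c) → record { simple = a ; connected = b ; acyclic = c })
    (λ t → let open IsTree t in simple , connected , acyclic)
    (isSimple? ×-dec connected? ×-dec acyclic?)

isSubgraph? : ∀ {n} (T H : Graph n) → Dec (IsSubgraph T H)
isSubgraph? T H = map′
  (λ (a , b) → record { vertices = a _ ; edges = b })
  (λ s → let open IsSubgraph s in (λ _ → vertices) , edges)
  (Fin.all? (λ u → (u ∈? V T) →-dec (u ∈? V H)) ×-dec
   Fin.all? (λ u → Fin.all? (λ v → _~?_ T u v →-dec _~?_ H u v)))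

isSteinerTree? : ∀ {n} (H : Graph n) S T → Dec (IsSteinerTree H S T)
isSteinerTree? H S T = map′
  (λ (a , b , c , d) → record
    { tree = a ; subgraph = b ; terminals = c _ ; leaves = d })
  (λ s → let open IsSteinerTree s in
    tree , subgraph , (λ _ → terminals) , leaves)
  (isTree? T ×-dec isSubgraph? T H ×-dec
   Fin.all? (λ v → (v ∈? S) →-dec (v ∈? V T)) ×-dec
   Fin.all? (λ v → (v ∈? V T) →-dec
     ((Graph.degree T v ≟ 1) →-dec (v ∈? S))))

independent? : ∀ {n} (S : Subset n) T U → Dec (Independent S T U)
independent? S T U = map′
  (λ (a , b , c) → record
    { edgeDisjoint = a ; commonVertices = b ; pathsDisjoint = c })
  (λ i → let open Independent i in
    edgeDisjoint , commonVertices , pathsDisjoint)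
  (Fin.all? (λ u → Fin.all? (λ v → ¬? (_~?_ T u v ×-dec _~?_ U u v)))
   ×-dec Vec.≡-dec Bool._≟_ (V T ∩ V U) S
   ×-dec Fin.all? (λ x → Fin.all? (λ y →
     (x ∈? S) →-dec ((y ∈? S) →-dec (¬? (x Fin.≟ y) →-dec
     allPaths? T x y (λ P → allPaths? U x y (λ Q →
     Fin.all? (λ z → (z ∈ₗ? P) →-dec ((z ∈ₗ? Q) →-dec
       ((z Fin.≟ x) ⊎-dec (z Fin.≟ y)))))))))))
  where open import Data.List.Membership.DecPropositional Fin._≟_
          renaming (_∈?_ to _∈ₗ?_) using ()

hasFamily? : ∀ {n} (H : Graph n) S → Decidable (HasFamily H S)
hasFamily? H S m = anyVec? anyGraph? (λ T → map′
  (λ (a , b) → record { steiner = a ; independent = b })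
  (λ i → let open IsCompletelyIndependent i in steiner , independent)
  (Fin.all? (λ p → isSteinerTree? H S (Vec.lookup T p))
   ×-dec Fin.all? (λ p → Fin.all? (λ q → (p Fin.<? q) →-dec
     independent? S (Vec.lookup T p) (Vec.lookup T q)))))

1≤∣S∣⇒nonempty : ∀ {n} (S : Subset n) → 1 ≤ ∣ S ∣ → Nonempty S
1≤∣S∣⇒nonempty (inside  ∷ S) _ = zero , here
1≤∣S∣⇒nonempty (outside ∷ S) l with 1≤∣S∣⇒nonempty S l
... | x , x∈S = suc x , there x∈S

2≤∣S∣⇒distinct : ∀ {n} (S : Subset n) → 2 ≤ ∣ S ∣ →
                 ∃ λ x → ∃ λ y → x ∈ S × y ∈ S × x ≢ y
2≤∣S∣⇒distinct (inside ∷ S) l with 1≤∣S∣⇒nonempty S (s≤s⁻¹ l)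
... | y , y∈S = zero , suc y , here , there y∈S , λ ()
2≤∣S∣⇒distinct (outside ∷ S) l with 2≤∣S∣⇒distinct S l
... | x , y , x∈S , y∈S , x≢y =
  suc x , suc y , there x∈S , there y∈S , x≢y ∘ Fin.suc-injective

path⇒neighbour : ∀ {n} (G : Graph n) {x y} P → x ≢ y → IsPath G x y P →
                 ∃ λ z → Graph._~_ G x z
path⇒neighbour G []          x≢y p = contradiction (IsPath.starts p) λ ()
path⇒neighbour G (u ∷ [])    x≢y p = contradiction
  (Maybe.just-injective (trans (sym (IsPath.starts p)) (IsPath.ends p))) x≢y
path⇒neighbour G (u ∷ z ∷ P) x≢y p with IsPath.starts p | IsPath.adjacent p
... | refl | u~z ∷ _ = z , u~z

hasFamily-bounded : ∀ {n} (H : Graph n) S → 2 ≤ ∣ S ∣ →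
                    ∀ m → HasFamily H S m → m ≤ n
hasFamily-bounded {n} H S 2≤∣S∣ m (T , ci) = Fin.injective⇒≤ first-injective
  where
  open IsCompletelyIndependent ci

  terminals : ∃ λ x → ∃ λ y → x ∈ S × y ∈ S × x ≢ y
  terminals = 2≤∣S∣⇒distinct S 2≤∣S∣

  x : Fin n
  x = proj₁ terminals

  step : ∀ p → ∃ λ z → Graph._~_ (Vec.lookup T p) x z
  step p with proj₂ terminals
  ... | y , x∈S , y∈S , x≢y
    with proj₂ (IsTree.connected tree) x y (terminals' x∈S) (terminals' y∈S)
    where open IsSteinerTree (steiner p) renaming (terminals to terminals')
  ... | P , path = path⇒neighbour (Vec.lookup T p) P x≢y path

  disjoint : ∀ {p q} → p Fin.< q → proj₁ (step p) ≢ proj₁ (step q)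
  disjoint {p} {q} p<q eq =
    Independent.edgeDisjoint (independent p q p<q) x (proj₁ (step q))
      ( subst (Graph._~_ (Vec.lookup T p) x) eq (proj₂ (step p))
      , proj₂ (step q))

  first-injective : ∀ {p q} → proj₁ (step p) ≡ proj₁ (step q) → p ≡ q
  first-injective {p} {q} eq with Fin.<-cmp p q
  ... | tri< p<q _ _ = contradiction eq (disjoint p<q)
  ... | tri≈ _ p≡q _ = p≡q
  ... | tri> _ _ q<p = contradiction (sym eq) (disjoint q<p)

hasFamily-zero : ∀ {n} (H : Graph n) S → HasFamily H S 0
hasFamily-zero H S = [] , record { steiner = λ () ; independent = λ () }

maximum-exists : ∀ {A : ℕ → Set} → Decidable A → A 0 →
                 ∀ b → (∀ i → A i → i ≤ b) → ∃ (IsMaximum A)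
maximum-exists A? a₀ zero    bound = 0 , a₀ , bound
maximum-exists A? a₀ (suc b) bound with A? (suc b)
... | yes a = suc b , a , bound
... | no ¬a = maximum-exists A? a₀ b λ i a →
  s≤s⁻¹ (ℕ.≤∧≢⇒< (bound i a) λ { refl → ¬a a })

minimum-exists : ∀ {A : ℕ → Set} → Decidable A → ∃ A → ∃ (IsMinimum A)
minimum-exists {A} A? (i , a) = search 0 i (ℕ.+-identityʳ i) (λ _ _ → z≤n)
  where
  open import Data.Nat using (_+_)
  search : ∀ j d → d + j ≡ i → (∀ l → A l → j ≤ l) → ∃ (IsMinimum A)
  search j zero    refl below = j , a , below
  search j (suc d) eq   below with A? j
  ... | yes aⱼ = j , aⱼ , below
  ... | no ¬aⱼ = search (suc j) d (trans (ℕ.+-suc d j) eq) λ l aₗ →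
    ℕ.≤∧≢⇒< (below l aₗ) λ { refl → ¬aⱼ aₗ }

-- The searches are abstract: κ* and κₖ* are known only as the maximum and
-- the minimum, through the second components of these proofs.
abstract
  κ*-exists : ∀ {n} (H : Graph n) S → 2 ≤ ∣ S ∣ → ∃ (IsMaximum (HasFamily H S))
  κ*-exists {n} H S 2≤∣S∣ = maximum-exists (hasFamily? H S)
    (hasFamily-zero H S) n (hasFamily-bounded H S 2≤∣S∣)

κ* : ∀ {n} (H : Graph n) (S : Subset n) → 2 ≤ ∣ S ∣ → ℕ
κ* H S 2≤∣S∣ = proj₁ (κ*-exists H S 2≤∣S∣)

IsKSubset : ∀ {n} → Graph n → ℕ → Subset n → Set
IsKSubset H k S = S ⊆ V H × ∣ S ∣ ≡ k

-- m = κ*_H(S) for some S ⊆ V(H) with |S| = k.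
IsValue : ∀ {n} → Graph n → (k : ℕ) → 2 ≤ k → ℕ → Set
IsValue H k 2≤k m = ∃ λ S → Σ (IsKSubset H k S) λ (_ , ∣S∣≡k) →
  κ* H S (subst (2 ≤_) (sym ∣S∣≡k) 2≤k) ≡ m

isValue? : ∀ {n} (H : Graph n) k (2≤k : 2 ≤ k) → Decidable (IsValue H k 2≤k)
isValue? H k 2≤k m = anySubset? go
  where
  go : ∀ R → Dec (Σ (IsKSubset H k R) λ (_ , ∣R∣≡k) →
                  κ* H R (subst (2 ≤_) (sym ∣R∣≡k) 2≤k) ≡ m)
  go R with R ⊆? V H | ∣ R ∣ ≟ k
  ... | no ¬s | _     = no λ ((s , _) , _) → ¬s s
  ... | yes _ | no ¬e = no λ ((_ , e) , _) → ¬e e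
  ... | yes s | yes refl = map′ (λ v → (s , refl) , v)
    (λ ((_ , e) , v) → trans (cong (κ* H R) (ℕ.≤-irrelevant _ _)) v)
    (κ* H R 2≤k ≟ m)

abstract
  κₖ*-exists : ∀ {n} (H : Graph n) k (2≤k : 2 ≤ k) → ∃ (IsKSubset H k) →
               ∃ (IsMinimum (IsValue H k 2≤k))
  κₖ*-exists H k 2≤k (S , S⊆V , ∣S∣≡k) = minimum-exists (isValue? H k 2≤k)
    (κ* H S (subst (2 ≤_) (sym ∣S∣≡k) 2≤k) , S , (S⊆V , ∣S∣≡k) , refl)

-- The last argument says that the minimum ranges over a nonempty set.
κₖ* : ∀ {n} (H : Graph n) (k : ℕ) → 2 ≤ k → ∃ (IsKSubset H k) → ℕ
κₖ* H k 2≤k S = proj₁ (κₖ*-exists H k 2≤k S)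

{-# OPTIONS --safe #-}

-- Fix a k-subset R of S and a completely independent family of R-Steiner
-- trees of G.  The trees with vertex set R lie in G[S].  Each of the others has
-- a vertex outside R, and these vertices are distinct because two trees share
-- only R, so there are at most |V(G)| − k others.

module Submission where

open import Defs
open import Data.Bool using (_∧_)
open import Data.Fin using (zero; suc)
import Data.Fin as Fin
import Data.Fin.Properties as Fin
open import Data.Fin.Subset using (Subset; _∈_; _∉_; _⊆_; _-_; ∣_∣)
open import Data.Fin.Subset.Properties
  using (⊆-refl; _∈?_; x∈p∩q⁺; p⊆q⇒∣p∣≤∣q∣; x∈p⇒∣p-x∣<∣p∣; x∈p∧x≢y⇒x∈p-y)
open import Data.Nat using (ℕ; suc; _≤_; _+_; _∸_; z≤n; s≤s)
import Data.Nat.Properties as ℕ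
open import Data.Product using (∃; _×_; _,_; proj₁; proj₂)
open import Data.Vec using (Vec; []; _∷_; lookup)
open import Data.Vec.Properties using ([]=⇒lookup; lookup⇒[]=; lookup∘tabulate)
open import Function using (_∘_)
open import Relation.Binary.PropositionalEquality
  using (_≡_; refl; sym; trans; subst; cong; cong₂)
open import Relation.Nullary using (yes; no)
open import Relation.Nullary.Decidable using (_×-dec_; ¬?; decidable-stable)

[]-adjacent : ∀ {n} (G : Graph n) (S : Subset n) {u v} → u ∈ S → v ∈ S →
              Graph._~_ G u v → Graph._~_ (G [ S ]) u v
[]-adjacent G S {u} {v} u∈S v∈S u~v = lookup⇒[]= v _
  (trans (cong (λ M → lookup M v) (lookup∘tabulate _ u))
  (trans (lookup∘tabulate _ v)
         (cong₂ _∧_ ([]=⇒lookup u∈S)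
           (cong₂ _∧_ ([]=⇒lookup v∈S) ([]=⇒lookup u~v)))))

-- Only the subgraph condition mentions the host graph. Both ends of an edge of `T` lie in `V T`,
-- the second one by symmetry, so the edge survives in `G [ S ]`.
steiner-in-[] : ∀ {n} (G : Graph n) {S R : Subset n} {T : Graph n} → V T ⊆ S →
                IsSteinerTree G R T → IsSteinerTree (G [ S ]) R T
steiner-in-[] G {S} V⊆S st = record
  { tree      = tree
  ; subgraph  = record
    { vertices = V⊆S
    ; edges    = λ u v u~v → []-adjacent G S
        (V⊆S (endpoints u v u~v)) (V⊆S (endpoints v u (symmetric u v u~v)))
        (IsSubgraph.edges subgraph u v u~v)
    }
  ; terminals = terminals
  ; leaves    = leaves
  }
  where
  open IsSteinerTree st
  open IsSimple (IsTree.simple tree)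

tail-independent : ∀ {n m} {H : Graph n} {S : Subset n} {t : Graph n}
                   {T : Vec (Graph n) m} →
                   IsCompletelyIndependent H S (t ∷ T) →
                   IsCompletelyIndependent H S T
tail-independent ci = record
  { steiner     = steiner ∘ suc
  ; independent = λ p q p<q → independent (suc p) (suc q) (s≤s p<q)
  }
  where open IsCompletelyIndependent ci

-- The count is additive to avoid truncated subtraction during the induction. Recording that each
-- kept tree occurs in `T` lets a further tree inherit its independence from the original family.
Restricted : ∀ {n m} → Graph n → Subset n → Subset n → Vec (Graph n) m →
             Subset n → Set
Restricted {n} {m} G S R T W =
  ∃ λ i → ∃ λ (U : Vec (Graph n) i) → IsCompletelyIndependent (G [ S ]) R U ×
    (∀ q → ∃ λ p → lookup T p ≡ lookup U q) × m + ∣ R ∣ ≤ i + ∣ W ∣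

-- W holds the vertices still available to the trees: it loses one vertex for
-- each tree that is discarded.
restrict-family :
  ∀ {n m} (G : Graph n) {S R : Subset n} → R ⊆ S →
  (T : Vec (Graph n) m) → IsCompletelyIndependent G R T →
  (W : Subset n) → R ⊆ W → (∀ p → V (lookup T p) ⊆ W) →
  Restricted G S R T W
restrict-family G R⊆S [] ci W R⊆W T⊆W =
  0 , [] , record { steiner = λ () ; independent = λ () } , (λ ()) ,
  p⊆q⇒∣p∣≤∣q∣ R⊆W
restrict-family {n} G {S} {R} R⊆S (t ∷ T) ci W R⊆W T⊆W
  with Fin.any? (λ v → (v ∈? V t) ×-dec ¬? (v ∈? R))
... | yes (v , v∈t , v∉R) = drop
  (restrict-family G R⊆S T (tail-independent ci) (W - v) R⊆W-v T⊆W-v)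
  where
  open IsCompletelyIndependent ci

  R⊆W-v : R ⊆ W - v
  R⊆W-v x∈R = x∈p∧x≢y⇒x∈p-y (R⊆W x∈R) λ { refl → v∉R x∈R }

  -- A second tree through `v` would put `v` into the common vertex set `R`.
  v∉T : ∀ p → v ∉ V (lookup T p)
  v∉T p v∈T = v∉R (subst (v ∈_)
    (Independent.commonVertices (independent zero (suc p) (s≤s z≤n)))
    (x∈p∩q⁺ (v∈t , v∈T)))

  T⊆W-v : ∀ p → V (lookup T p) ⊆ W - v
  T⊆W-v p x∈T = x∈p∧x≢y⇒x∈p-y (T⊆W (suc p) x∈T) λ { refl → v∉T p x∈T }

  drop : Restricted G S R T (W - v) → Restricted G S R (t ∷ T) W
  drop (i , U , ciU , U⊆T , l) =
    i , U , ciU , (λ q → suc (proj₁ (U⊆T q)) , proj₂ (U⊆T q)) ,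
    -- The discarded tree adds one on the left, which the strict drop from `W` to `W - v` pays for.
    ℕ.≤-trans (s≤s l)
      (ℕ.≤-trans (ℕ.≤-reflexive (sym (ℕ.+-suc i _)))
        (ℕ.+-monoʳ-≤ i (x∈p⇒∣p-x∣<∣p∣ (T⊆W zero v∈t))))
... | no none = keep (restrict-family G R⊆S T (tail-independent ci) W R⊆W (T⊆W ∘ suc))
  where
  open IsCompletelyIndependent ci

  t⊆R : V t ⊆ R
  t⊆R {v} v∈t = decidable-stable (v ∈? R) λ v∉R → none (v , v∈t , v∉R)

  keep : Restricted G S R T W → Restricted G S R (t ∷ T) W
  keep (i , U , ciU , U⊆T , l) =
    suc i , t ∷ U ,
    record { steiner = steiner′ ; independent = independent′ } ,
    (λ { zero → zero , refl ; (suc q) → suc (proj₁ (U⊆T q)) , proj₂ (U⊆T q) }) ,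
    s≤s l
    where
    module U = IsCompletelyIndependent ciU

    steiner′ : ∀ p → IsSteinerTree (G [ S ]) R (lookup (t ∷ U) p)
    steiner′ zero    = steiner-in-[] G (R⊆S ∘ t⊆R) (steiner zero)
    steiner′ (suc p) = U.steiner p

    independent′ : ∀ p q → p Fin.< q →
                   Independent R (lookup (t ∷ U) p) (lookup (t ∷ U) q)
    -- `Independent` does not refer to the host graph, so independence within the family of `G`
    -- carries over unchanged.
    independent′ zero    (suc q) _ = subst (Independent R t) (proj₂ (U⊆T q))
      (independent zero (suc (proj₁ (U⊆T q))) (s≤s z≤n))
    independent′ (suc p) (suc q) (s≤s p<q) = U.independent p q p<q

κ*-[]-bound : ∀ {n} (G : Graph n) {S R : Subset n} → R ⊆ S → R ⊆ V G →
              (2≤∣R∣ : 2 ≤ ∣ R ∣) →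
              κ* G R 2≤∣R∣ ≤ κ* (G [ S ]) R 2≤∣R∣ + (∣ V G ∣ ∸ ∣ R ∣)
κ*-[]-bound G {S} {R} R⊆S R⊆V 2≤∣R∣
  with κ*-exists G R 2≤∣R∣ | κ*-exists (G [ S ]) R 2≤∣R∣
... | m , (T , ci) , _ | κ , _ , maximal
  -- At the start every vertex of `G` is available, and `T` is a maximum family for `R`.
  with restrict-family G R⊆S T ci (V G) R⊆V
         (λ p → IsSubgraph.vertices (IsSteinerTree.subgraph
                  (IsCompletelyIndependent.steiner ci p)))
... | i , U , ciU , _ , l = begin
  m                          ≤⟨ ℕ.m+n≤o⇒m≤o∸n m l ⟩
  (i + ∣ V G ∣) ∸ ∣ R ∣      ≡⟨ ℕ.+-∸-assoc i (p⊆q⇒∣p∣≤∣q∣ R⊆V) ⟩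
  i + (∣ V G ∣ ∸ ∣ R ∣)      ≤⟨ ℕ.+-monoˡ-≤ _ (maximal i (U , ciU)) ⟩
  κ + (∣ V G ∣ ∸ ∣ R ∣)      ∎
  where open ℕ.≤-Reasoning

theorem2p4 : ∀ {n} (G : Graph n) → IsSimple G → Connected G →
    ∀ (S : Subset n) (S⊆V : S ⊆ V G) (k : ℕ) (∣S∣≡k : ∣ S ∣ ≡ k) (2≤k : 2 ≤ k) →
    κₖ* G k 2≤k (S , S⊆V , ∣S∣≡k)
    ≤ κₖ* (G [ S ]) k 2≤k (S , ⊆-refl , ∣S∣≡k) + (∣ V G ∣ ∸ k)
theorem2p4 G _ _ S S⊆V k ∣S∣≡k 2≤k
  with κₖ*-exists G k 2≤k (S , S⊆V , ∣S∣≡k)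
     | κₖ*-exists (G [ S ]) k 2≤k (S , ⊆-refl , ∣S∣≡k)
-- `R` attains the minimum for `G [ S ]`. It is also a `k`-subset of `V G`, so its value in `G`
-- bounds the minimum `a` from above.
... | a , _ , minimal | b , (R , (R⊆S , refl) , refl) , _ =
  ℕ.≤-trans (minimal (κ* G R 2≤k) (R , (S⊆V ∘ R⊆S , refl) , refl))
            (κ*-[]-bound G R⊆S (S⊆V ∘ R⊆S) 2≤k)
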